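{- For every $n\in\mathbb{N}$, the boolean quadric polytope $\mathrm{BQP}(n)$ is affinely equivalent to some face of the linear ordering polytope $\mathrm{LOP}(2n)$.
   Context: The boolean quadric polytope $\mathrm{BQP}(n)$ is the convex hull of all vectors $\mathbf{x}=(x_{ij})_{1\le i\le j\le n}\in\{0,1\}^{n(n+1)/2}$ satisfying $x_{ij}=x_{ii}x_{jj}$ for all $1\le i<j\le n$. For $m\in\mathbb{N}$, a linear order on $[m]=\{1,\dots,m\}$ is a set $L$ of ordered pairs $(i,j)$, $i\neq j$, such that for each pair $i\neq j$ exactly one of $(i,j),(j,i)$ lies in $L$, and $L$ is transitive ($(i,j),(j,k)\in L\Rightarrow (i,k)\in L$). Its characteristic vector $\mathbf{y}\in\{0,1\}^{m(m-1)/2}$ has coordinates $y_{ij}$, $1\le i<j\le m$, with $y_{ij}=1$ if $(i,j)\in L$ and $y_{ij}=0$ if $(j,i)\in L$. The linear ordering polytope $\mathrm{LOP}(m)$ is the convex hull of all such characteristic vectors. A hyperplane $H$ is supporting for a polytope $P$ if $P\cap H\neq\emptyset$ and $P$ lies entirely on one side of $H$; a face of $P$ is the intersection of $P$ with one or several supporting hyperplanes. Two polytopes $P,Q$ are affinely equivalent if there is an invertible affine map $\alpha$ with $\alpha(P)=Q$ (equivalently, an affine bijection between them).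
   Formalization: A polytope counts as a face of itself (no supporting hyperplane needed); with "one or several" the claim fails for n=1, where BQP(1)=LOP(2)=[0,1]. For n≥2 dimensions force at least one hyperplane. Stated over any ordered field, which includes the reals. -}

module Defs where

open import Algebra.Apartness.Structures using (IsHeytingField)
open import Algebra.Bundles.Raw using (RawMonoid)
open import Data.Fin.Base as Fin using (Fin)
open import Data.List.Base using (List)
open import Data.List.Relation.Unary.All using (All)
open import Data.Nat.Base using (ℕ)
open import Data.Nat.Properties using (≤-refl; <⇒≤)
open import Data.Product.Base using (_×_; _,_; ∃-syntax; Σ-syntax)
open import Data.Sum.Base using (_⊎_)
open import Function.Bundles using (_⇔_)
open import Level using (Level; _⊔_; suc; 0ℓ)
open import Relation.Binary.Core using (Rel)
open import Relation.Binary.PropositionalEquality.Core using (_≡_)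
open import Relation.Binary.Structures using (IsStrictTotalOrder; IsTotalOrder)
open import Relation.Unary using (Pred; _∈_; _∩_; _≐_; Satisfiable)
import Algebra.Definitions.RawMonoid

-- The library has no real numbers, so the polytopes are built over an
-- arbitrary (totally) ordered field; ℝ and ℚ are examples.
record OrderedField (c ℓ : Level) : Set (suc (c ⊔ ℓ)) where
  infix  8 -_
  infixl 7 _*_
  infixl 6 _+_
  infix  4 _≈_ _#_ _≤_
  field
    Carrier        : Set c
    _≈_ _#_ _≤_    : Rel Carrier ℓ
    _+_ _*_        : Carrier → Carrier → Carrier
    -_             : Carrier → Carrier
    0# 1#          : Carrier
    isHeytingField : IsHeytingField _≈_ _#_ _+_ _*_ -_ 0# 1#
    isTotalOrder   : IsTotalOrder _≈_ _≤_
    +-monoˡ-≤      : ∀ z {x y} → x ≤ y → x + z ≤ y + z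
    *-nonNeg       : ∀ {x y} → 0# ≤ x → 0# ≤ y → 0# ≤ x * y

-- The pairs (i , j) with i R j, as an index set for coordinates.  The proof is
-- irrelevant, so a coordinate depends on i and j only.
record PairsIn {n : ℕ} (R : Rel (Fin n) 0ℓ) : Set where
  constructor pair
  field
    fst snd  : Fin n
    .related : R fst snd

module Polytopes {c ℓ : Level} (K : OrderedField c ℓ) where

  open OrderedField K

  +-rawMonoid : RawMonoid c ℓ
  +-rawMonoid = record { Carrier = Carrier ; _≈_ = _≈_ ; _∙_ = _+_ ; ε = 0# }

  open Algebra.Definitions.RawMonoid +-rawMonoid using (sum)

  -- The space K^I; it is only used for finite I.
  Point : Set → Set c
  Point I = I → Carrier

  infix 4 _≋_
  _≋_ : {I : Set} → Rel (Point I) ℓ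
  x ≋ y = ∀ i → x i ≈ y i

  record ConvexCombination {I : Set} {a : Level} (S : Pred (Point I) a)
                           (x : Point I) : Set (c ⊔ ℓ ⊔ a) where
    field
      size           : ℕ
      weight         : Fin size → Carrier
      point          : Fin size → Point I
      weight-nonNeg  : ∀ k → 0# ≤ weight k
      weight-sum     : sum weight ≈ 1#
      point∈         : ∀ k → point k ∈ S
      combination    : ∀ i → x i ≈ sum (λ k → weight k * point k i)

  conv : {I : Set} {a : Level} → Pred (Point I) a → Pred (Point I) (c ⊔ ℓ ⊔ a)
  conv S x = ConvexCombination S x

  -- Affine functions K^I → K: those that preserve affine combinations.
  record AffineFunction (I : Set) : Set (c ⊔ ℓ) where
    field
      ⟦_⟧    : Point I → Carrier
      cong   : ∀ {x y} → x ≋ y → ⟦ x ⟧ ≈ ⟦ y ⟧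
      affine : ∀ s t x y → s + t ≈ 1# →
               ⟦ (λ i → s * x i + t * y i) ⟧ ≈ s * ⟦ x ⟧ + t * ⟦ y ⟧
  open AffineFunction public using (⟦_⟧)

  -- A map K^I → K^J is affine iff each of its coordinates is.
  AffineMap : Set → Set → Set (c ⊔ ℓ)
  AffineMap I J = J → AffineFunction I

  apply : {I J : Set} → AffineMap I J → Point I → Point J
  apply α x j = ⟦ α j ⟧ x

  -- The hyperplane { x | form x = 0 } of a nonconstant affine function.
  record Hyperplane (I : Set) : Set (c ⊔ ℓ) where
    field
      form        : AffineFunction I
      nonconstant : ∃[ x ] ∃[ y ] ⟦ form ⟧ x # ⟦ form ⟧ y
  open Hyperplane public

  ⟨_⟩ : {I : Set} → Hyperplane I → Pred (Point I) ℓ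
  ⟨ H ⟩ x = ⟦ form H ⟧ x ≈ 0#

  Supporting : {I : Set} {a : Level} → Pred (Point I) a → Hyperplane I →
               Set (c ⊔ ℓ ⊔ a)
  Supporting P H =
    Satisfiable (P ∩ ⟨ H ⟩) ×
    ((∀ x → x ∈ P → ⟦ form H ⟧ x ≤ 0#) ⊎ (∀ x → x ∈ P → 0# ≤ ⟦ form H ⟧ x))

  -- The empty list of hyperplanes is allowed: P is a face of itself.  This is
  -- needed because a full-dimensional P lies in no hyperplane; e.g. BQP 1 and
  -- LOP 2 are both the segment from 0 to 1 in K^1.
  IsFaceOf : {I : Set} {a b : Level} → Pred (Point I) b → Pred (Point I) a →
             Set (c ⊔ ℓ ⊔ a ⊔ b)
  IsFaceOf {I} F P =
    Σ[ Hs ∈ List (Hyperplane I) ]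
      All (Supporting P) Hs × F ≐ (P ∩ (λ x → All (λ H → x ∈ ⟨ H ⟩) Hs))

  -- The ambient dimensions may differ, so invertibility is that of the
  -- restriction P → Q, with inverse given by an affine map as well.
  record AffinelyEquivalent {I J : Set} {a b : Level}
         (P : Pred (Point I) a) (Q : Pred (Point J) b) : Set (c ⊔ ℓ ⊔ a ⊔ b) where
    field
      to      : AffineMap I J
      from    : AffineMap J I
      image   : ∀ y → y ∈ Q ⇔ (∃[ x ] x ∈ P × apply to x ≋ y)
      inverse : ∀ x → x ∈ P → apply from (apply to x) ≋ x

  BQPIndex LOPIndex : ℕ → Set
  BQPIndex n = PairsIn {n} Fin._≤_
  LOPIndex m = PairsIn {m} Fin._<_

  diag : {n : ℕ} → Fin n → BQPIndex n
  diag i = pair i i ≤-refl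

  record BQPVertex (n : ℕ) (x : Point (BQPIndex n)) : Set ℓ where
    field
      binary  : ∀ p → x p ≈ 0# ⊎ x p ≈ 1#
      product : ∀ i j (i<j : i Fin.< j) →
                x (pair i j (<⇒≤ i<j)) ≈ x (diag i) * x (diag j)

  BQP : (n : ℕ) → Pred (Point (BQPIndex n)) (c ⊔ ℓ)
  BQP n = conv (BQPVertex n)

  IsCharacteristicVector : {m : ℕ} → Rel (Fin m) 0ℓ → Pred (Point (LOPIndex m)) ℓ
  IsCharacteristicVector L y = ∀ i j (i<j : i Fin.< j) →
    (L i j → y (pair i j i<j) ≈ 1#) × (L j i → y (pair i j i<j) ≈ 0#)

  LOPVertex : (m : ℕ) → Pred (Point (LOPIndex m)) (suc 0ℓ ⊔ ℓ)
  LOPVertex m y =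
    Σ[ L ∈ Rel (Fin m) 0ℓ ] IsStrictTotalOrder _≡_ L × IsCharacteristicVector L y

  LOP : (m : ℕ) → Pred (Point (LOPIndex m)) (suc 0ℓ ⊔ c ⊔ ℓ)
  LOP m = conv (LOPVertex m)

{-# OPTIONS --safe #-}

-- Write a i and b i for the elements i and n + i of [2n].  The vertex of BQP n with
-- diagonal bits β goes to the order that lists first the a i with β i = 1, then the
-- pairs b i , a i with β i = 0, then the b i with β i = 1, each group by increasing i.
-- Between the blocks i < j this order satisfies
--   [a i < b j] = 1,                  [a j < b i] = x i + x j - x i x j,
--   [a i < a j] = 1 - x j + x i x j,  [b i < b j] = 1 - x i + x i x j,
-- so the map is affine in the coordinates of BQP n.  These orders are exactly the ones
-- for which, for all i < j, the inequality [a i < b j] ≤ 1 and the 3-cycle inequalities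
--   [a i < b i] + [b i < a j] ≥ [a i < a j],  [a j < b j] + [b i < a j] ≥ [b i < b j]
-- are tight.
module Submission where

open import Defs
open import Algebra.Bundles using (CommutativeRing)
import Algebra.Properties.AbelianGroup as AbelianGroupProperties
import Algebra.Properties.CommutativeSemigroup as CommutativeSemigroupProperties
import Algebra.Properties.Ring as RingProperties
import Algebra.Properties.Semiring.Sum as SemiringSum
open import Data.Bool.Base using (Bool; true; false; not; _∧_; _∨_; if_then_else_)
open import Data.Bool.Properties using (∧-comm; ∧-idem; ∨-zeroʳ)
open import Data.Empty using (⊥-elim)
open import Data.Fin.Base as Fin using (Fin; toℕ; combine; remQuot)
open import Data.Fin.Patterns using (0F; 1F; 2F)
open import Data.Fin.Properties as Fin using (combine-monoˡ-<; combine-remQuot; remQuot-combine; toℕ-combine)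
open import Data.List.Base as List using (List; []; _++_; allFin; cartesianProduct)
open import Data.List.Membership.Propositional using () renaming (_∈_ to _∈ₗ_)
open import Data.List.Membership.Propositional.Properties using (∈-++⁺ˡ; ∈-++⁺ʳ; ∈-map⁺; ∈-allFin; ∈-cartesianProduct⁺)
open import Data.List.Relation.Unary.All as All using (All)
import Data.List.Relation.Unary.All.Properties as All
import Data.List.Relation.Unary.Any as Any
open import Data.Nat.Base using (ℕ; _*_; z<s; s<s; s<s⁻¹)
import Data.Nat.Properties as ℕ
open import Data.Product.Base using (Σ-syntax; ∃-syntax; ∃; _×_; _,_; proj₁; proj₂; uncurry)
open import Data.Sum.Base as Sum using (_⊎_; inj₁; inj₂; [_,_]′)
open import Function.Base using (_∘_; case_of_)
open import Function.Bundles using (mk⇔)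
open import Level using (Level; _⊔_; 0ℓ)
open import Relation.Binary.Core using (Rel)
open import Relation.Binary.Definitions using (Tri; tri<; tri≈; tri>; Trichotomous)
open import Relation.Binary.PropositionalEquality.Core as ≡ using (_≡_)
open import Relation.Binary.PropositionalEquality.Properties using (isEquivalence)
import Relation.Binary.Reasoning.Setoid as SetoidReasoning
open import Relation.Binary.Structures using (IsStrictTotalOrder; IsTotalOrder)
open import Relation.Nullary.Decidable using (dec-true)
open import Relation.Nullary.Decidable.Core using (does; yes; recompute)
open import Relation.Nullary.Negation.Core using (¬_; contradiction)
open import Relation.Unary using (Pred; _∈_; _∩_)

-- Arithmetic and order in an ordered field, and indicators of Booleans.

module OrderedFieldProperties {c ℓ : Level} (K : OrderedField c ℓ) where

  open import Data.Fin.Base using (zero; suc)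
  open import Data.Nat.Base using (zero; suc)
  open OrderedField K renaming (_*_ to infixl 7 _·_)
  open import Algebra.Apartness.Structures _≈_ _#_ _+_ _·_ -_ 0# 1# using (IsHeytingField)
  open IsHeytingField isHeytingField using (isCommutativeRing; invertible⇒#; #-irrefl)

  commutativeRing : CommutativeRing c ℓ
  commutativeRing = record { isCommutativeRing = isCommutativeRing }

  open CommutativeRing commutativeRing public
    using ( refl; sym; trans; setoid; reflexive; ring; semiring; +-abelianGroup
          ; +-commutativeSemigroup; +-cong; +-congˡ; +-congʳ; -‿cong; *-cong; *-congˡ; *-congʳ
          ; +-identityˡ; +-identityʳ; *-identityˡ; *-identityʳ; zeroˡ; distribˡ
          ; +-assoc; +-comm; -‿inverseˡ; -‿inverseʳ)
  open RingProperties ring public using (-0#≈0#; -‿distribʳ-*; -‿distribˡ-*)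
  open AbelianGroupProperties +-abelianGroup public using (⁻¹-∙-comm; ⁻¹-involutive)
  open CommutativeSemigroupProperties +-commutativeSemigroup public using (interchange; x∙yz≈y∙xz)
  open SemiringSum semiring public using (sum; sum-cong-≋; ∑-distrib-+)
  open IsTotalOrder isTotalOrder public
    using (total; antisym; ≤-respˡ-≈; ≤-respʳ-≈)
    renaming (refl to ≤-refl; reflexive to ≤-reflexive; trans to ≤-trans)
  open SetoidReasoning setoid

  x-x≈0 : ∀ {x y} → x ≈ y → x + - y ≈ 0#
  x-x≈0 {y = y} x≈y = trans (+-congʳ x≈y) (-‿inverseʳ y)

  x-0≈x : ∀ x → x + - 0# ≈ x
  x-0≈x x = trans (+-congˡ -0#≈0#) (+-identityʳ x)

  -‿interchange : ∀ u v x y → (u + - v) + (x + - y) ≈ (u + x) + - (v + y)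
  -‿interchange u v x y =
    trans (interchange u (- v) x (- y)) (+-congˡ (⁻¹-∙-comm v y))

  x-[x-y]≈y : ∀ x y → x + - (x + - y) ≈ y
  x-[x-y]≈y x y = begin
    x + - (x + - y)     ≈⟨ +-congˡ (⁻¹-∙-comm x (- y)) ⟨
    x + (- x + - - y)   ≈⟨ +-assoc x (- x) (- - y) ⟨
    (x + - x) + - - y   ≈⟨ +-cong (-‿inverseʳ x) (⁻¹-involutive y) ⟩
    0# + y              ≈⟨ +-identityˡ y ⟩
    y                   ∎

  -- This is why both 3-cycle inequalities are tight on the image. For `x` = x i and `y` = x j - x i
  -- x j it reads [a i < b i] + [b i < a j] = [a i < a j], and exchanging i and j gives the other
  -- one.
  x+[1-[x+y]]≈1-y : ∀ x y → x + (1# + - (x + y)) ≈ 1# + - y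
  x+[1-[x+y]]≈1-y x y = begin
    x + (1# + - (x + y))     ≈⟨ x∙yz≈y∙xz x 1# (- (x + y)) ⟩
    1# + (x + - (x + y))     ≈⟨ +-congˡ (+-congˡ (⁻¹-∙-comm x y)) ⟨
    1# + (x + (- x + - y))   ≈⟨ +-congˡ (+-assoc x (- x) (- y)) ⟨
    1# + ((x + - x) + - y)   ≈⟨ +-congˡ (trans (+-congʳ (-‿inverseʳ x)) (+-identityˡ (- y))) ⟩
    1# + - y                 ∎

  sum-minus : ∀ {n} (f g : Fin n → Carrier) → sum (λ k → f k + - g k) ≈ sum f + - sum g
  sum-minus {zero}  f g = sym (x-0≈x 0#)
  sum-minus {suc n} f g =
    trans (+-congˡ (sum-minus (f ∘ suc) (g ∘ suc))) (-‿interchange _ _ _ _)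

  -- Apartness follows from an invertible difference, and here the difference is 1, its own inverse.
  1-invertible⇒# : ∀ {x y} → x ≈ 1# → y ≈ 0# → x # y
  1-invertible⇒# {x} {y} x≈1 y≈0 =
    invertible⇒# (1# , trans (*-identityˡ _) x-y≈1 , trans (*-identityʳ _) x-y≈1)
    where
    x-y≈1 : x + - y ≈ 1#
    x-y≈1 = trans (+-cong x≈1 (-‿cong y≈0)) (x-0≈x 1#)

  1≉0 : ¬ 1# ≈ 0#
  1≉0 1≈0 = #-irrefl refl (1-invertible⇒# (sym 1≈0) refl)

  +-mono-≤ : ∀ {u v x y} → u ≤ v → x ≤ y → u + x ≤ v + y
  +-mono-≤ {u} {v} {x} {y} u≤v x≤y = ≤-trans (+-monoˡ-≤ x u≤v)
    (≤-respˡ-≈ (+-comm x v) (≤-respʳ-≈ (+-comm y v) (+-monoˡ-≤ v x≤y)))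

  0≤y-x : ∀ {x y} → x ≤ y → 0# ≤ y + - x
  0≤y-x {x} x≤y = ≤-respˡ-≈ (-‿inverseʳ x) (+-monoˡ-≤ (- x) x≤y)

  -- By totality the other case is `1# ≤ 0#`; then -1 is nonnegative, and so is its square, which is
  -- 1.
  0≤1 : 0# ≤ 1#
  0≤1 with total 0# 1#
  ... | inj₁ 0≤1 = 0≤1
  ... | inj₂ 1≤0 = ≤-respʳ-≈ -1*-1≈1 (*-nonNeg 0≤-1 0≤-1)
    where
    0≤-1 : 0# ≤ - 1#
    0≤-1 = ≤-respʳ-≈ (+-identityˡ (- 1#)) (0≤y-x 1≤0)
    -1*-1≈1 : - 1# · - 1# ≈ 1#
    -1*-1≈1 = begin
      - 1# · - 1#     ≈⟨ -‿distribˡ-* 1# (- 1#) ⟨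
      - (1# · - 1#)   ≈⟨ -‿cong (*-identityˡ (- 1#)) ⟩
      - - 1#          ≈⟨ ⁻¹-involutive 1# ⟩
      1#              ∎

  1≰0 : ¬ 1# ≤ 0#
  1≰0 1≤0 = 1≉0 (antisym 1≤0 0≤1)

  -- The difference is the product of the nonnegative elements `x` and `y - 1`. It serves to bound a
  -- weight by its product with a slack of at least 1.
  x≤x*y : ∀ {x y} → 0# ≤ x → 1# ≤ y → x ≤ x · y
  x≤x*y {x} {y} 0≤x 1≤y =
    ≤-respˡ-≈ (+-identityˡ x) (≤-respʳ-≈ lemma (+-monoˡ-≤ x (*-nonNeg 0≤x (0≤y-x 1≤y))))
    where
    lemma : x · (y + - 1#) + x ≈ x · y
    lemma = begin
      x · (y + - 1#) + x        ≈⟨ +-congˡ (*-identityʳ x) ⟨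
      x · (y + - 1#) + x · 1#   ≈⟨ distribˡ x (y + - 1#) 1# ⟨
      x · ((y + - 1#) + 1#)     ≈⟨ *-congˡ (trans (+-assoc y (- 1#) 1#) (trans (+-congˡ (-‿inverseˡ 1#)) (+-identityʳ y))) ⟩
      x · y                     ∎

  sum-nonNeg : ∀ {n} {f : Fin n → Carrier} → (∀ k → 0# ≤ f k) → 0# ≤ sum f
  sum-nonNeg {zero}  0≤f = ≤-refl
  sum-nonNeg {suc n} 0≤f =
    ≤-respˡ-≈ (+-identityˡ 0#) (+-mono-≤ (0≤f zero) (sum-nonNeg (0≤f ∘ suc)))

  term≤sum : ∀ {n} {f : Fin n → Carrier} → (∀ k → 0# ≤ f k) → ∀ k → f k ≤ sum f
  term≤sum {f = f} 0≤f zero    =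
    ≤-respˡ-≈ (+-identityʳ (f zero)) (+-mono-≤ ≤-refl (sum-nonNeg (0≤f ∘ suc)))
  term≤sum {f = f} 0≤f (suc k) =
    ≤-respˡ-≈ (+-identityˡ (f (suc k))) (+-mono-≤ (0≤f zero) (term≤sum (0≤f ∘ suc) k))

  indicator : Bool → Carrier
  indicator b = if b then 1# else 0#

  indicator-∧ : ∀ p q → indicator (p ∧ q) ≈ indicator p · indicator q
  indicator-∧ true  q = sym (*-identityˡ _)
  indicator-∧ false q = sym (zeroˡ _)

  indicator-not : ∀ p → 1# + - indicator p ≈ indicator (not p)
  indicator-not true  = -‿inverseʳ 1#
  indicator-not false = x-0≈x 1#

  indicator-∖ : ∀ p q → indicator p + - indicator (p ∧ q) ≈ indicator (p ∧ not q)
  indicator-∖ true  q = indicator-not q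
  indicator-∖ false q = x-0≈x 0#

  -- The summands are never both 1, since `q ∧ not p` excludes `p`; hence the sum computes a
  -- disjunction.
  indicator-∨ : ∀ p q → indicator p + indicator (q ∧ not p) ≈ indicator (p ∨ q)
  indicator-∨ true  true  = +-identityʳ 1#
  indicator-∨ true  false = +-identityʳ 1#
  indicator-∨ false true  = +-identityˡ 1#
  indicator-∨ false false = +-identityˡ 0#

  -- The slack is the integer p + q - r. The hypothesis excludes -1, its only negative value, and 0
  -- means that `r` is the disjoint union of `p` and `q`.
  cover-slack : ∀ p q r → (r ≡ true → p ∨ q ≡ true) →
    ((r ≡ p ∨ q × p ∧ q ≡ false) × (indicator p + indicator q) + - indicator r ≈ 0#) ⊎
    1# ≤ (indicator p + indicator q) + - indicator r
  cover-slack true  true  true  _ =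
    inj₂ (≤-reflexive (sym (trans (+-assoc 1# 1# (- 1#)) (trans (+-congˡ (-‿inverseʳ 1#)) (+-identityʳ 1#)))))
  cover-slack true  true  false _ =
    inj₂ (≤-respʳ-≈ (sym (x-0≈x _)) (≤-respˡ-≈ (+-identityˡ 1#) (+-monoˡ-≤ 1# 0≤1)))
  cover-slack true  false true  _ = inj₁ ((≡.refl , ≡.refl) , x-x≈0 (+-identityʳ 1#))
  cover-slack true  false false _ = inj₂ (≤-reflexive (sym (trans (x-0≈x _) (+-identityʳ 1#))))
  cover-slack false true  true  _ = inj₁ ((≡.refl , ≡.refl) , x-x≈0 (+-identityˡ 1#))
  cover-slack false true  false _ = inj₂ (≤-reflexive (sym (trans (x-0≈x _) (+-identityˡ 1#))))
  cover-slack false false true  r⇒p∨q = case r⇒p∨q ≡.refl of λ ()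
  cover-slack false false false _ = inj₁ ((≡.refl , ≡.refl) , x-x≈0 (+-identityˡ 0#))

-- Affine expressions, convex hulls and their faces.

module PolytopeProperties {c ℓ : Level} (K : OrderedField c ℓ) where

  open OrderedField K renaming (_*_ to infixl 7 _·_)
  open OrderedFieldProperties K
  open Polytopes K
  open SetoidReasoning setoid

  infixl 6 _⊕_ _⊝_

  -- Affine forms with integer coefficients, kept as syntax: that they respect affine combinations
  -- of any length is then an induction, whereas `AffineFunction` speaks of two points only.
  data AffineExpr (I : Set) : Set where
    𝟙       : AffineExpr I
    var     : I → AffineExpr I
    _⊕_ _⊝_ : AffineExpr I → AffineExpr I → AffineExpr I

  eval : {I : Set} → AffineExpr I → Point I → Carrier
  eval 𝟙       x = 1#
  eval (var i) x = x i
  eval (e ⊕ f) x = eval e x + eval f x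
  eval (e ⊝ f) x = eval e x + - eval f x

  eval-cong : {I : Set} (e : AffineExpr I) {x y : Point I} → x ≋ y → eval e x ≈ eval e y
  eval-cong 𝟙       x≋y = refl
  eval-cong (var i) x≋y = x≋y i
  eval-cong (e ⊕ f) x≋y = +-cong (eval-cong e x≋y) (eval-cong f x≋y)
  eval-cong (e ⊝ f) x≋y = +-cong (eval-cong e x≋y) (-‿cong (eval-cong f x≋y))

  eval-sum : {I : Set} (e : AffineExpr I) {n : ℕ} (w : Fin n → Carrier) (x : Fin n → Point I) →
             sum w ≈ 1# →
             eval e (λ i → sum (λ k → w k · x k i)) ≈ sum (λ k → w k · eval e (x k))
  eval-sum 𝟙       w x Σw≈1 = trans (sym Σw≈1) (sum-cong-≋ (λ k → sym (*-identityʳ (w k))))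
  eval-sum (var i) w x Σw≈1 = refl
  eval-sum (e ⊕ f) w x Σw≈1 = begin
    _ ≈⟨ +-cong (eval-sum e w x Σw≈1) (eval-sum f w x Σw≈1) ⟩
    _ ≈⟨ ∑-distrib-+ (λ k → w k · eval e (x k)) (λ k → w k · eval f (x k)) ⟨
    _ ≈⟨ sum-cong-≋ (λ k → distribˡ (w k) (eval e (x k)) (eval f (x k))) ⟨
    _ ∎
  eval-sum (e ⊝ f) w x Σw≈1 = begin
    _ ≈⟨ +-cong (eval-sum e w x Σw≈1) (-‿cong (eval-sum f w x Σw≈1)) ⟩
    _ ≈⟨ sum-minus (λ k → w k · eval e (x k)) (λ k → w k · eval f (x k)) ⟨
    _ ≈⟨ sum-cong-≋ (λ k → +-congˡ (-‿distribʳ-* (w k) (eval f (x k)))) ⟩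
    _ ≈⟨ sum-cong-≋ (λ k → distribˡ (w k) (eval e (x k)) (- eval f (x k))) ⟨
    _ ∎

  affineFunction : {I : Set} → AffineExpr I → AffineFunction I
  affineFunction {I} e = record
    { ⟦_⟧    = eval e
    ; cong   = eval-cong e
    ; affine = affine
    }
    where
    affine : ∀ s t x y → s + t ≈ 1# →
             eval e (λ i → s · x i + t · y i) ≈ s · eval e x + t · eval e y
    affine s t x y s+t≈1 = begin
      -- A sum over `Fin 2` unfolds to `u + (v + 0#)`; the trailing zero is inserted here and
      -- removed at the end.
      _ ≈⟨ eval-cong e (λ i → +-congˡ (+-identityʳ (t · y i))) ⟨
      _ ≈⟨ eval-sum e w z (trans (+-congˡ (+-identityʳ t)) s+t≈1) ⟩
      _ ≈⟨ +-congˡ (+-identityʳ (t · eval e y)) ⟩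
      _ ∎
      where
      w : Fin 2 → Carrier
      w 0F = s
      w 1F = t
      z : Fin 2 → Point I
      z 0F = x
      z 1F = y

  evalAll : {I J : Set} → (J → AffineExpr I) → Point I → Point J
  evalAll es x j = eval (es j) x

  ⊆-conv : {I : Set} {a : Level} {S : Pred (Point I) a} {x : Point I} → x ∈ S → x ∈ conv S
  ⊆-conv {x = x} x∈S = record
    { size          = 1
    ; weight        = λ _ → 1#
    ; point         = λ _ → x
    ; weight-nonNeg = λ _ → 0≤1
    ; weight-sum    = +-identityʳ 1#
    ; point∈        = λ _ → x∈S
    ; combination   = λ i → sym (trans (+-identityʳ _) (*-identityˡ (x i)))
    }

  -- Equality with 0 is not assumed decidable in K, so a point of the face cannot be freed
  -- of its zero weights.  Instead each vertex is classified by its slacks: a slack ≥ 1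
  -- forces the weight of the vertex to vanish.
  conv≃face :
    {I J C : Set} {a b : Level} {V : Pred (Point I) a} {S : Pred (Point J) b}
    (to : J → AffineExpr I) (from : I → AffineExpr J)
    (slack : C → AffineExpr J) (cs : List C) → (∀ d → d ∈ₗ cs) →
    (∀ d → ∃[ x ] ∃[ y ] eval (slack d) x # eval (slack d) y) →
    ∃ V →
    (∀ {x} → x ∈ V → evalAll to x ∈ S) →
    (∀ x → evalAll from (evalAll to x) ≋ x) →
    (∀ d x → eval (slack d) (evalAll to x) ≈ 0#) →
    (∀ {s} → s ∈ S → ∀ d → eval (slack d) s ≈ 0# ⊎ 1# ≤ eval (slack d) s) →
    (∀ {s} → s ∈ S → (∀ d → eval (slack d) s ≈ 0#) → ∃[ x ] x ∈ V × evalAll to x ≋ s) →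
    Σ[ F ∈ Pred (Point J) (c ⊔ ℓ ⊔ b) ] IsFaceOf F (conv S) × AffinelyEquivalent (conv V) F
  conv≃face {I} {J} {C} {V = V} {S} to from slack cs complete nonconstant (v₀ , v₀∈V)
            to∈S from∘to to-tight integral lift =
    F ,
    (hyperplanes , All.map⁺ (All.universal supporting cs) , (λ y∈F → y∈F) , (λ y∈F → y∈F)) ,
    record
      { to      = affineFunction ∘ to
      ; from    = affineFunction ∘ from
      ; image   = λ y → mk⇔ F⊆image image⊆F
      ; inverse = λ x _ → from∘to x
      }
    where
    open ConvexCombination

    hyperplane : C → Hyperplane J
    hyperplane d = record { form = affineFunction (slack d) ; nonconstant = nonconstant d }

    hyperplanes : List (Hyperplane J)
    hyperplanes = List.map hyperplane cs

    F : Pred (Point J) _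
    F = conv S ∩ (λ y → All (λ H → y ∈ ⟨ H ⟩) hyperplanes)

    slack-nonNeg : ∀ {s} → s ∈ S → ∀ d → 0# ≤ eval (slack d) s
    slack-nonNeg s∈S d = [ ≤-reflexive ∘ sym , ≤-trans 0≤1 ]′ (integral s∈S d)

    slack-sum : ∀ {y} (Y : y ∈ conv S) d →
                eval (slack d) y ≈ sum (λ k → weight Y k · eval (slack d) (point Y k))
    slack-sum Y d = trans (eval-cong (slack d) (combination Y))
                          (eval-sum (slack d) (weight Y) (point Y) (weight-sum Y))

    weighted-slack-nonNeg : ∀ {y} (Y : y ∈ conv S) d k →
                            0# ≤ weight Y k · eval (slack d) (point Y k)
    weighted-slack-nonNeg Y d k = *-nonNeg (weight-nonNeg Y k) (slack-nonNeg (point∈ Y k) d)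

    supporting : ∀ d → Supporting (conv S) (hyperplane d)
    supporting d =
      (evalAll to v₀ , ⊆-conv (to∈S v₀∈V) , to-tight d v₀) ,
      inj₂ (λ y Y → ≤-respʳ-≈ (sym (slack-sum Y d)) (sum-nonNeg (weighted-slack-nonNeg Y d)))

    image⊆F : ∀ {y} → (∃[ x ] x ∈ conv V × evalAll to x ≋ y) → y ∈ F
    image⊆F {y} (x , X , to-x≋y) = Y , All.map⁺ (All.universal tight cs)
      where
      Y : y ∈ conv S
      Y = record
        { size          = size X
        ; weight        = weight X
        ; point         = evalAll to ∘ point X
        ; weight-nonNeg = weight-nonNeg X
        ; weight-sum    = weight-sum X
        ; point∈        = to∈S ∘ point∈ X
        ; combination   = λ j → begin
            y j             ≈⟨ to-x≋y j ⟨
            eval (to j) x   ≈⟨ eval-cong (to j) (combination X) ⟩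
            _               ≈⟨ eval-sum (to j) (weight X) (point X) (weight-sum X) ⟩
            _               ∎
        }
      tight : ∀ d → eval (slack d) y ≈ 0#
      tight d = trans (eval-cong (slack d) (λ j → sym (to-x≋y j))) (to-tight d x)

    F⊆image : ∀ {y} → y ∈ F → ∃[ x ] x ∈ conv V × evalAll to x ≋ y
    F⊆image {y} (Y , y-tight) = x , X , to-x≋y
      where
      slack≈0 : ∀ d → eval (slack d) y ≈ 0#
      slack≈0 d = All.lookup (All.map⁻ y-tight) (complete d)

      -- The weight is at most its product with the slack, and that product is one nonnegative term
      -- of a sum equal to the slack at `y`, which is 0.
      weight≈0 : ∀ k d → 1# ≤ eval (slack d) (point Y k) → weight Y k ≈ 0#
      weight≈0 k d 1≤slack = antisym
        (≤-trans (x≤x*y (weight-nonNeg Y k) 1≤slack)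
          (≤-respʳ-≈ (trans (sym (slack-sum Y d)) (slack≈0 d))
            (term≤sum (weighted-slack-nonNeg Y d) k)))
        (weight-nonNeg Y k)

      preimage : ∀ k → ∃[ v ] v ∈ V × (∀ j → weight Y k · eval (to j) v ≈ weight Y k · point Y k j)
      preimage k with All.decide (integral (point∈ Y k)) cs
      ... | inj₁ tight with lift (point∈ Y k) (λ d → All.lookup tight (complete d))
      ...   | v , v∈V , to-v≋s = v , v∈V , (λ j → *-congˡ (to-v≋s j))
      -- The weight is zero here, so `v₀` is a placeholder that leaves the combination unchanged.
      preimage k | inj₂ slackness = v₀ , v₀∈V , λ j → trans (w*≈0 _) (sym (w*≈0 _))
        where
        w*≈0 : ∀ z → weight Y k · z ≈ 0#
        w*≈0 z = trans (*-congʳ (uncurry (weight≈0 k) (Any.satisfied slackness))) (zeroˡ z)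

      x : Point I
      x i = sum (λ k → weight Y k · proj₁ (preimage k) i)

      X : x ∈ conv V
      X = record
        { size          = size Y
        ; weight        = weight Y
        ; point         = proj₁ ∘ preimage
        ; weight-nonNeg = weight-nonNeg Y
        ; weight-sum    = weight-sum Y
        ; point∈        = proj₁ ∘ proj₂ ∘ preimage
        ; combination   = λ i → refl
        }

      to-x≋y : evalAll to x ≋ y
      to-x≋y j = begin
        eval (to j) x                         ≈⟨ eval-sum (to j) (weight Y) (proj₁ ∘ preimage) (weight-sum Y) ⟩
        _                                     ≈⟨ sum-cong-≋ (λ k → proj₂ (proj₂ (preimage k)) j) ⟩
        sum (λ k → weight Y k · point Y k j)  ≈⟨ combination Y j ⟨
        y j                                   ∎

-- Monotonicity of `combine` and enumeration of index pairs.

combine-monoʳ-< : ∀ {m n} (k : Fin m) {i j : Fin n} → i Fin.< j → combine k i Fin.< combine k j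
combine-monoʳ-< {n = n} k {i} {j} i<j
  rewrite toℕ-combine k i | toℕ-combine k j = ℕ.+-monoʳ-< (n * toℕ k) i<j

module FinPairs where

  open import Data.Fin.Base using (zero; suc)
  open import Data.Nat.Base using (zero; suc)

  allPairs : ∀ n → List (PairsIn {n} Fin._<_)
  allPairs zero    = []
  allPairs (suc n) =
    List.map (λ j → pair zero (suc j) z<s) (allFin n) ++
    List.map (λ (pair i j i<j) → pair (suc i) (suc j) (s<s i<j)) (allPairs n)

  ∈-allPairs : ∀ {n} (p : PairsIn {n} Fin._<_) → p ∈ₗ allPairs n
  ∈-allPairs (pair zero    (suc j) i<j) = ∈-++⁺ˡ (∈-map⁺ _ (∈-allFin j))
  ∈-allPairs (pair (suc i) (suc j) i<j) =
    ∈-++⁺ʳ _ (∈-map⁺ _ (∈-allPairs (pair i j (s<s⁻¹ i<j))))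

open FinPairs

-- The elements a i and b i, and the kinds of coordinates of the linear ordering polytope.

module Elements (n : ℕ) where

  -- (0F , i) and (1F , i) stand for a i and b i.
  Label : Set
  Label = Fin 2 × Fin n

  element : Label → Fin (2 * n)
  element (t , i) = combine {2} t i

  label : Fin (2 * n) → Label
  label = remQuot n

  -- The pairs u , v with element u < element v; in ba it is a j that precedes b i.
  data Increasing : Label → Label → Set where
    aa : ∀ {i j} → i Fin.< j → Increasing (0F , i) (0F , j)
    bb : ∀ {i j} → i Fin.< j → Increasing (1F , i) (1F , j)
    ab : ∀ {i j} → i Fin.< j → Increasing (0F , i) (1F , j)
    ba : ∀ {i j} → i Fin.< j → Increasing (0F , j) (1F , i)
    ii : ∀ {i}   → Increasing (0F , i) (1F , i)

  -- The constructors follow the trichotomy of the two block indices, so at most one applies, and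
  -- its proof of `<` is unique.
  Increasing-irrelevant : ∀ {u v} (p q : Increasing u v) → p ≡ q
  Increasing-irrelevant (aa p) (aa q) = ≡.cong aa (ℕ.<-irrelevant p q)
  Increasing-irrelevant (bb p) (bb q) = ≡.cong bb (ℕ.<-irrelevant p q)
  Increasing-irrelevant (ab p) (ab q) = ≡.cong ab (ℕ.<-irrelevant p q)
  Increasing-irrelevant (ab p) (ba q) = contradiction q (ℕ.<-asym p)
  Increasing-irrelevant (ab p) ii     = contradiction p (ℕ.<-irrefl ≡.refl)
  Increasing-irrelevant (ba p) (ab q) = contradiction q (ℕ.<-asym p)
  Increasing-irrelevant (ba p) (ba q) = ≡.cong ba (ℕ.<-irrelevant p q)
  Increasing-irrelevant (ba p) ii     = contradiction p (ℕ.<-irrefl ≡.refl)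
  Increasing-irrelevant ii     (ab q) = contradiction q (ℕ.<-irrefl ≡.refl)
  Increasing-irrelevant ii     (ba q) = contradiction q (ℕ.<-irrefl ≡.refl)
  Increasing-irrelevant ii     ii     = ≡.refl

  element-monoˡ-< : ∀ {s t} i j → s Fin.< t → element (s , i) Fin.< element (t , j)
  element-monoˡ-< = combine-monoˡ-<

  element-monoʳ-< : ∀ t {i j} → i Fin.< j → element (t , i) Fin.< element (t , j)
  element-monoʳ-< t = combine-monoʳ-< t

  element-mono-< : ∀ {u v} → Increasing u v → element u Fin.< element v
  element-mono-< (aa i<j)       = element-monoʳ-< 0F i<j
  element-mono-< (bb i<j)       = element-monoʳ-< 1F i<j
  element-mono-< (ab {i} {j} _) = element-monoˡ-< {0F} {1F} i j z<s
  element-mono-< (ba {i} {j} _) = element-monoˡ-< {0F} {1F} j i z<s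
  element-mono-< (ii {i})       = element-monoˡ-< {0F} {1F} i i z<s

  increasing : ∀ u v → element u Fin.< element v → Increasing u v
  increasing (s , i) (t , j) u<v with Fin.<-cmp i j
  increasing (0F , i) (0F , j) u<v | tri< i<j _ _    = aa i<j
  increasing (0F , i) (0F , j) u<v | tri≈ _ ≡.refl _ = contradiction u<v (ℕ.<-irrefl ≡.refl)
  increasing (0F , i) (0F , j) u<v | tri> _ _ j<i    = contradiction u<v (ℕ.<-asym (element-monoʳ-< 0F j<i))
  increasing (0F , i) (1F , j) u<v | tri< i<j _ _    = ab i<j
  increasing (0F , i) (1F , j) u<v | tri≈ _ ≡.refl _ = ii
  increasing (0F , i) (1F , j) u<v | tri> _ _ j<i    = ba j<i
  increasing (1F , i) (0F , j) u<v | _               = contradiction u<v (ℕ.<-asym (element-monoˡ-< {0F} {1F} j i z<s))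
  increasing (1F , i) (1F , j) u<v | tri< i<j _ _    = bb i<j
  increasing (1F , i) (1F , j) u<v | tri≈ _ ≡.refl _ = contradiction u<v (ℕ.<-irrefl ≡.refl)
  increasing (1F , i) (1F , j) u<v | tri> _ _ j<i    = contradiction u<v (ℕ.<-asym (element-monoʳ-< 1F j<i))

  Index : Set
  Index = PairsIn {2 * n} Fin._<_

  index : ∀ {u v} → Increasing u v → Index
  index {u} {v} u<v = pair (element u) (element v) (element-mono-< u<v)

  labels-increasing : (p : Index) → Increasing (label (PairsIn.fst p)) (label (PairsIn.snd p))
  labels-increasing (pair u v u<v) = increasing (label u) (label v)
    (≡.subst₂ Fin._<_ (≡.sym (combine-remQuot {2} n u)) (≡.sym (combine-remQuot {2} n v))
      -- The inequality stored in a pair is irrelevant; decidability of `<` makes it usable again.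
      (recompute (u Fin.<? v) u<v))

  index-surjective : ∀ p → index (labels-increasing p) ≡ p
  index-surjective (pair u v u<v) = pair-cong (combine-remQuot {2} n u) (combine-remQuot {2} n v)
    where
    pair-cong : ∀ {u u′ v v′ : Fin (2 * n)} .{u<v : u Fin.< v} .{u′<v′ : u′ Fin.< v′} →
                u ≡ u′ → v ≡ v′ → pair u v u<v ≡ pair u′ v′ u′<v′
    pair-cong ≡.refl ≡.refl = ≡.refl

  -- The labels of `index p` agree with those of `p` only propositionally, so the two proofs have
  -- different types. Passing both through `f` avoids a transport.
  labels-increasing-index : ∀ {a} {A : Set a} (f : ∀ {u v} → Increasing u v → A) →
                            ∀ {u v} (p : Increasing u v) → f (labels-increasing (index p)) ≡ f p
  labels-increasing-index f {u} {v} p =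
    unique (remQuot-combine (proj₁ u) (proj₂ u)) (remQuot-combine (proj₁ v) (proj₂ v)) _ p
    where
    unique : ∀ {u u′ v v′} → u ≡ u′ → v ≡ v′ →
             (p : Increasing u v) (q : Increasing u′ v′) → f p ≡ f q
    unique ≡.refl ≡.refl p q = ≡.cong f (Increasing-irrelevant p q)

  -- The linear order that belongs to given bits.

  slot : Fin 3 → Fin n → Fin 2 → Fin (3 * (n * 2))
  slot g i t = combine {3} g (combine {n} i t)

  slot-group-< : ∀ {g h i j s t} → g Fin.< h → slot g i s Fin.< slot h j t
  slot-group-< {i = i} {j} {s} {t} = combine-monoˡ-< (combine {n} i s) (combine {n} j t)

  slot-index-< : ∀ g {i j s t} → i Fin.< j → slot g i s Fin.< slot g j t
  slot-index-< g {s = s} {t} i<j = combine-monoʳ-< {3} g (combine-monoˡ-< {n} s t i<j)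

  slot-last-< : ∀ g i {s t} → s Fin.< t → slot g i s Fin.< slot g i t
  slot-last-< g i s<t = combine-monoʳ-< {3} g (combine-monoʳ-< {n} i s<t)

  OrderedAs : Bool → ∀ {m} → Fin m → Fin m → Set
  OrderedAs true  r s = r Fin.< s
  OrderedAs false r s = s Fin.< r

  module _ (β : Fin n → Bool) where

    -- Boolean form of the affine formulas: for instance, a j overtakes a i exactly when β j = 1 and
    -- β i = 0.
    precedes : ∀ {u v} → Increasing u v → Bool
    precedes (aa {i} {j} _) = not (β j ∧ not (β i))
    precedes (bb {i} {j} _) = not (β i ∧ not (β j))
    precedes (ab _)         = true
    precedes (ba {i} {j} _) = β i ∨ β j
    precedes (ii {i})       = β i

    -- Positions are compared lexicographically by group, block and place. In the middle group b i
    -- takes place 0 and a i place 1, so that b i comes just before a i.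
    rank : Label → Fin (3 * (n * 2))
    rank (0F , i) = if β i then slot 0F i 0F else slot 1F i 1F
    rank (1F , i) = if β i then slot 2F i 0F else slot 1F i 0F

    precedes-correct : ∀ {u v} (p : Increasing u v) → OrderedAs (precedes p) (rank u) (rank v)
    precedes-correct (aa {i} {j} i<j) with β i | β j
    ... | true  | true  = slot-index-< 0F i<j
    ... | true  | false = slot-group-< {0F} {1F} z<s
    ... | false | true  = slot-group-< {0F} {1F} z<s
    ... | false | false = slot-index-< 1F i<j
    precedes-correct (bb {i} {j} i<j) with β i | β j
    ... | true  | true  = slot-index-< 2F i<j
    ... | true  | false = slot-group-< {1F} {2F} (s<s z<s)
    ... | false | true  = slot-group-< {1F} {2F} (s<s z<s)
    ... | false | false = slot-index-< 1F i<j
    precedes-correct (ab {i} {j} i<j) with β i | β j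
    ... | true  | true  = slot-group-< {0F} {2F} z<s
    ... | true  | false = slot-group-< {0F} {1F} z<s
    ... | false | true  = slot-group-< {1F} {2F} (s<s z<s)
    ... | false | false = slot-index-< 1F i<j
    precedes-correct (ba {i} {j} i<j) with β i | β j
    ... | true  | true  = slot-group-< {0F} {2F} z<s
    ... | true  | false = slot-group-< {1F} {2F} (s<s z<s)
    ... | false | true  = slot-group-< {0F} {1F} z<s
    ... | false | false = slot-index-< 1F i<j
    precedes-correct (ii {i}) with β i
    ... | true  = slot-group-< {0F} {2F} z<s
    ... | false = slot-last-< 1F i z<s

    RankOrder : Rel (Fin (2 * n)) 0ℓ
    RankOrder u v = rank (label u) Fin.< rank (label v)

    -- `precedes-correct` compares the ranks of any two distinct elements strictly, so injectivity
    -- of `rank` comes along with totality.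
    RankOrder-total : ∀ {u v} → u Fin.< v → RankOrder u v ⊎ RankOrder v u
    RankOrder-total {u} {v} u<v = split _ (precedes-correct (labels-increasing (pair u v u<v)))
      where
      split : ∀ b → OrderedAs b (rank (label u)) (rank (label v)) → RankOrder u v ⊎ RankOrder v u
      split true  = inj₁
      split false = inj₂

    RankOrder-isStrictTotalOrder : IsStrictTotalOrder _≡_ RankOrder
    RankOrder-isStrictTotalOrder = record
      { isStrictPartialOrder = record
        { isEquivalence = isEquivalence
        ; irrefl        = λ { ≡.refl → ℕ.<-irrefl ≡.refl }
        ; trans         = ℕ.<-trans
        ; <-resp-≈      = (λ { ≡.refl r → r }) , (λ { ≡.refl r → r })
        }
      ; compare = compare
      }
      where
      lt : ∀ {u v} → RankOrder u v → Tri (RankOrder u v) (u ≡ v) (RankOrder v u)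
      lt r = tri< r (λ { ≡.refl → ℕ.<-irrefl ≡.refl r }) (ℕ.<-asym r)
      gt : ∀ {u v} → RankOrder v u → Tri (RankOrder u v) (u ≡ v) (RankOrder v u)
      gt r = tri> (ℕ.<-asym r) (λ { ≡.refl → ℕ.<-irrefl ≡.refl r }) r
      compare : Trichotomous _≡_ RankOrder
      compare u v with Fin.<-cmp u v
      ... | tri< u<v _ _    = [ lt , gt ]′ (RankOrder-total u<v)
      ... | tri≈ _ ≡.refl _ = tri≈ (ℕ.<-irrefl ≡.refl) ≡.refl (ℕ.<-irrefl ≡.refl)
      ... | tri> _ _ v<u    = [ gt , lt ]′ (RankOrder-total v<u)

-- The affine map from `BQP n` and its inverse.

module BooleanQuadricFace {c ℓ : Level} (K : OrderedField c ℓ) (n : ℕ) where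

  open OrderedField K renaming (_*_ to infixl 7 _·_)
  open OrderedFieldProperties K
  open PolytopeProperties K
  open Polytopes K
  open Elements n

  x⟨_⟩ : ∀ {i j : Fin n} → i Fin.< j → AffineExpr (BQPIndex n)
  x⟨_⟩ {i} {j} i<j = var (pair i j (ℕ.<⇒≤ i<j))

  x[_] : Fin n → AffineExpr (BQPIndex n)
  x[ i ] = var (diag i)

  precedence : ∀ {u v} → Increasing u v → AffineExpr (BQPIndex n)
  precedence (aa {i} {j} i<j) = 𝟙 ⊝ (x[ j ] ⊝ x⟨ i<j ⟩)
  precedence (bb {i} {j} i<j) = 𝟙 ⊝ (x[ i ] ⊝ x⟨ i<j ⟩)
  precedence (ab _)           = 𝟙
  precedence (ba {i} {j} i<j) = x[ i ] ⊕ (x[ j ] ⊝ x⟨ i<j ⟩)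
  precedence (ii {i})         = x[ i ]

  to : LOPIndex (2 * n) → AffineExpr (BQPIndex n)
  to p = precedence (labels-increasing p)

  y : ∀ {u v} → Increasing u v → AffineExpr (LOPIndex (2 * n))
  y u<v = var (index u<v)

  y-to : ∀ {u v} (p : Increasing u v) x → eval (y p) (evalAll to x) ≈ eval (precedence p) x
  y-to p x = reflexive (labels-increasing-index (λ q → eval (precedence q) x) p)

  -- The diagonal is x i = [a i < b i], and solving [a i < a j] = 1 - (x j - x i j) for x i j gives
  -- the rest.
  from : BQPIndex n → AffineExpr (LOPIndex (2 * n))
  from (pair i j i≤j) with Fin.<-cmp i j
  ... | tri< i<j _ _ = y (ii {j}) ⊝ (𝟙 ⊝ y (aa i<j))
  -- This is the case i = j; the case j < i contradicts `i≤j` and takes the same value by default.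
  ... | _            = y (ii {i})

  from∘to : ∀ x → evalAll from (evalAll to x) ≋ x
  from∘to x (pair i j i≤j) with Fin.<-cmp i j
  ... | tri< i<j _ _ = begin
    _ ≈⟨ +-cong (y-to (ii {j}) x) (-‿cong (+-congˡ (-‿cong (y-to (aa i<j) x)))) ⟩
    _ ≈⟨ +-congˡ (-‿cong (x-[x-y]≈y 1# _)) ⟩
    _ ≈⟨ x-[x-y]≈y (x (diag j)) _ ⟩
    _ ∎
    where open SetoidReasoning setoid
  ... | tri≈ _ ≡.refl _ = y-to (ii {i}) x
  ... | tri> _ _ j<i    = ⊥-elim (ℕ.<⇒≱ j<i (recompute (i Fin.≤? j) i≤j))

  -- The three families of inequalities that cut out the face.

  cover : {I : Set} → AffineExpr I → AffineExpr I → AffineExpr I → AffineExpr I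
  cover e f g = (e ⊕ f) ⊝ g

  Constraint : Set
  Constraint = Fin 3 × PairsIn {n} Fin._<_

  -- 1 - [a i < b j] is padded with 1 - 1 to give all three slacks the same shape.
  slack′ : Fin 3 → ∀ {i j : Fin n} → i Fin.< j → AffineExpr (LOPIndex (2 * n))
  slack′ 0F         i<j = cover 𝟙            (𝟙 ⊝ 𝟙)          (y (ab i<j))
  slack′ 1F {i} {j} i<j = cover (y (ii {i})) (𝟙 ⊝ y (ba i<j)) (y (aa i<j))
  slack′ 2F {i} {j} i<j = cover (y (ii {j})) (𝟙 ⊝ y (ba i<j)) (y (bb i<j))

  slack : Constraint → AffineExpr (LOPIndex (2 * n))
  slack (k , pair i j i<j) = slack′ k (recompute (i Fin.<? j) i<j)

  slack-nonconstant : ∀ d → ∃[ x ] ∃[ z ] eval (slack d) x # eval (slack d) z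
  slack-nonconstant (k , pair i j i<j) =
    -- Every slack is 1 at the all-zero point and 0 at the all-one point.
    (λ _ → 0#) , (λ _ → 1#) , 1-invertible⇒# (at0 k _) (at1 k _)
    where
    0+[1-0]-0 : (0# + (1# + - 0#)) + - 0# ≈ 1#
    0+[1-0]-0 = trans (x-0≈x _) (trans (+-identityˡ _) (x-0≈x 1#))
    1+[1-1]-1 : (1# + (1# + - 1#)) + - 1# ≈ 0#
    1+[1-1]-1 = x-x≈0 (trans (+-congˡ (-‿inverseʳ 1#)) (+-identityʳ 1#))
    at0 : ∀ k {i j : Fin n} (i<j : i Fin.< j) → eval (slack′ k i<j) (λ _ → 0#) ≈ 1#
    at0 0F _ = trans (x-0≈x _) (trans (+-congˡ (-‿inverseʳ 1#)) (+-identityʳ 1#))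
    at0 1F _ = 0+[1-0]-0
    at0 2F _ = 0+[1-0]-0
    at1 : ∀ k {i j : Fin n} (i<j : i Fin.< j) → eval (slack′ k i<j) (λ _ → 1#) ≈ 0#
    at1 0F _ = 1+[1-1]-1
    at1 1F _ = 1+[1-1]-1
    at1 2F _ = 1+[1-1]-1

  -- The off-diagonal coordinates enter as independent variables, so these are linear identities
  -- that hold at every point of the space, not only at vertices.
  to-tight : ∀ d x → eval (slack d) (evalAll to x) ≈ 0#
  to-tight (k , pair i j i<j) x = tight k _
    where
    tight : ∀ k {i j : Fin n} (i<j : i Fin.< j) → eval (slack′ k i<j) (evalAll to x) ≈ 0#
    tight 0F i<j = x-x≈0 (trans (trans (+-congˡ (-‿inverseʳ 1#)) (+-identityʳ 1#)) (sym (y-to (ab i<j) x)))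
    tight 1F {i} i<j = x-x≈0 (trans (+-cong (y-to (ii {i}) x) (+-congˡ (-‿cong (y-to (ba i<j) x))))
      (trans (x+[1-[x+y]]≈1-y _ _) (sym (y-to (aa i<j) x))))
    -- Since [a j < b i] is symmetric in x i and x j, exchanging them reduces this case to the same
    -- identity as the previous one.
    tight 2F {i} {j} i<j = x-x≈0 (trans
      (+-cong (y-to (ii {j}) x)
        (+-congˡ (-‿cong (trans (y-to (ba i<j) x) (x∙yz≈y∙xz (x (diag i)) (x (diag j)) _)))))
      (trans (x+[1-[x+y]]≈1-y _ _) (sym (y-to (bb i<j) x))))

  -- The vertices of `BQP n` and their images.

  vertex : (Fin n → Bool) → Point (BQPIndex n)
  vertex β (pair i j _) = indicator (β i ∧ β j)

  -- The uniform formula in `vertex` puts `β i ∧ β i` on the diagonal; this turns it into `β i`.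
  ∧-idem-indicator : ∀ p → indicator (p ∧ p) ≈ indicator p
  ∧-idem-indicator p = reflexive (≡.cong indicator (∧-idem p))

  vertex-isVertex : ∀ β → BQPVertex n (vertex β)
  vertex-isVertex β = record
    { binary  = λ (pair i j _) → binary (β i ∧ β j)
    ; product = λ i j _ → trans (indicator-∧ (β i) (β j))
        (*-cong (sym (∧-idem-indicator (β i))) (sym (∧-idem-indicator (β j))))
    }
    where
    binary : ∀ p → indicator p ≈ 0# ⊎ indicator p ≈ 1#
    binary true  = inj₂ refl
    binary false = inj₁ refl

  -- The bits are read off the disjunctions in `binary`, so equality in `K` is never decided; the
  -- product condition then fixes the remaining coordinates.
  isVertex⇒vertex : ∀ {x} → BQPVertex n x → ∃[ β ] x ≋ vertex β
  isVertex⇒vertex {x} V = β , x≋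
    where
    open BQPVertex V
    bit : ∀ {z} → z ≈ 0# ⊎ z ≈ 1# → ∃[ b ] z ≈ indicator b
    bit (inj₁ z≈0) = false , z≈0
    bit (inj₂ z≈1) = true , z≈1
    β : Fin n → Bool
    β i = proj₁ (bit (binary (diag i)))
    x-diag : ∀ i → x (diag i) ≈ indicator (β i)
    x-diag i = proj₂ (bit (binary (diag i)))
    x≋ : x ≋ vertex β
    x≋ (pair i j i≤j) with Fin.<-cmp i j
    ... | tri< i<j _ _    = trans (product i j i<j) (trans (*-cong (x-diag i) (x-diag j)) (sym (indicator-∧ (β i) (β j))))
    ... | tri≈ _ ≡.refl _ = trans (x-diag i) (sym (∧-idem-indicator (β i)))
    ... | tri> _ _ j<i    = ⊥-elim (ℕ.<⇒≱ j<i (recompute (i Fin.≤? j) i≤j))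

  -- At a vertex x i j is the indicator of `β i ∧ β j`, so a difference x j - x i j becomes the
  -- indicator of `β j ∧ not (β i)`.
  precedence-vertex : ∀ β {u v} (p : Increasing u v) →
                      eval (precedence p) (vertex β) ≈ indicator (precedes β p)
  precedence-vertex β (aa {i} {j} _) = trans
    (+-congˡ (-‿cong (trans
      (+-cong (∧-idem-indicator (β j)) (-‿cong (reflexive (≡.cong indicator (∧-comm (β i) (β j))))))
      (indicator-∖ (β j) (β i)))))
    (indicator-not _)
  precedence-vertex β (bb {i} {j} _) = trans
    (+-congˡ (-‿cong (trans (+-congʳ (∧-idem-indicator (β i))) (indicator-∖ (β i) (β j)))))
    (indicator-not _)
  precedence-vertex β (ab _) = refl
  precedence-vertex β (ba {i} {j} _) = trans
    (+-cong (∧-idem-indicator (β i)) (trans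
      (+-cong (∧-idem-indicator (β j)) (-‿cong (reflexive (≡.cong indicator (∧-comm (β i) (β j))))))
      (indicator-∖ (β j) (β i))))
    (indicator-∨ (β i) (β j))
  precedence-vertex β (ii {i}) = ∧-idem-indicator (β i)

  to-isVertex : ∀ {x} → BQPVertex n x → LOPVertex (2 * n) (evalAll to x)
  to-isVertex {x} V with isVertex⇒vertex V
  ... | β , x≋ = RankOrder β , RankOrder-isStrictTotalOrder β , λ u v u<v →
    characteristic (precedes-correct β (labels-increasing (pair u v u<v)))
      (trans (eval-cong (to (pair u v u<v)) x≋) (precedence-vertex β (labels-increasing (pair u v u<v))))
    where
    characteristic : ∀ {u v b z} → OrderedAs b (rank β (label u)) (rank β (label v)) → z ≈ indicator b →
                     (RankOrder β u v → z ≈ 1#) × (RankOrder β v u → z ≈ 0#)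
    characteristic {b = true}  r z≈1 = (λ _ → z≈1) , λ r′ → contradiction r′ (ℕ.<-asym r)
    characteristic {b = false} r z≈0 = (λ r′ → contradiction r′ (ℕ.<-asym r)) , λ _ → z≈0

  -- Slacks of an arbitrary linear order, and recovery of its bits.

  module LinearOrder {L : Rel (Fin (2 * n)) 0ℓ} (isSTO : IsStrictTotalOrder _≡_ L)
                     {s : Point (LOPIndex (2 * n))} (s-char : IsCharacteristicVector L s) where

    open IsStrictTotalOrder isSTO using (_<?_; compare) renaming (trans to L-trans)

    below : Label → Label → Bool
    below u v = does (element u <? element v)

    below⇒L : ∀ u v → below u v ≡ true → L (element u) (element v)
    below⇒L u v eq with element u <? element v
    ... | yes u<v = u<v

    L⇒below : ∀ u v → L (element u) (element v) → below u v ≡ true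
    L⇒below u v u<v = dec-true (element u <? element v) u<v

    ¬below⇒L : ∀ {u v} → Increasing u v → below u v ≡ false → L (element v) (element u)
    -- `_<?_` is computed from `compare`, so in the case `tri<` the equation `eq` is absurd and no
    -- clause remains.
    ¬below⇒L {u} {v} p eq with compare (element u) (element v)
    ... | tri≈ _ u≡v _ = contradiction (element-mono-< p) (ℕ.<-irrefl (≡.cong toℕ u≡v))
    ... | tri> _ _ v<u = v<u

    below-trans : ∀ u v w → below u v ≡ true → below v w ≡ true → below u w ≡ true
    below-trans u v w u<v v<w = L⇒below u w (L-trans (below⇒L u v u<v) (below⇒L v w v<w))

    s-below : ∀ {u v} (p : Increasing u v) → s (index p) ≈ indicator (below u v)
    s-below {u} {v} p with below u v in eq
    ... | true  = proj₁ (s-char _ _ (element-mono-< p)) (below⇒L u v eq)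
    ... | false = proj₂ (s-char _ _ (element-mono-< p)) (¬below⇒L p eq)

    β : Fin n → Bool
    β i = below (0F , i) (1F , i)

    -- The combinatorial content of a vanishing slack. In the 3-cycle cases
    -- `not (below (0F , j) (1F , i))` is b i < a j, and the larger side must be a disjoint union of
    -- the two others.
    Tight : Fin 3 → Fin n → Fin n → Set
    Tight 0F i j = below (0F , i) (1F , j) ≡ true
    Tight 1F i j = below (0F , i) (0F , j) ≡ β i ∨ not (below (0F , j) (1F , i)) ×
                   β i ∧ not (below (0F , j) (1F , i)) ≡ false
    Tight 2F i j = below (1F , i) (1F , j) ≡ β j ∨ not (below (0F , j) (1F , i)) ×
                   β j ∧ not (below (0F , j) (1F , i)) ≡ false

    -- Transitivity of `L` supplies the covering hypothesis of `cover-slack`, after which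
    -- integrality leaves 0 or at least 1.
    slack-dichotomy : ∀ k {i j : Fin n} (i<j : i Fin.< j) →
                      (Tight k i j × eval (slack′ k i<j) s ≈ 0#) ⊎ 1# ≤ eval (slack′ k i<j) s
    slack-dichotomy k {i} {j} i<j = by-cover k
      where
      1-s-below : 1# + - s (index (ba i<j)) ≈ indicator (not (below (0F , j) (1F , i)))
      1-s-below = trans (+-congˡ (-‿cong (s-below (ba i<j)))) (indicator-not _)

      transfer : ∀ {A B : Set} {p q r p′ q′ r′} → p ≈ p′ → q ≈ q′ → r ≈ r′ → (A → B) →
                 (A × (p′ + q′) + - r′ ≈ 0#) ⊎ 1# ≤ (p′ + q′) + - r′ →
                 (B × (p + q) + - r ≈ 0#) ⊎ 1# ≤ (p + q) + - r
      transfer {p = p} {q} {r} p≈ q≈ r≈ A⇒B =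
        Sum.map (λ (a , v≈0) → A⇒B a , trans v≈ v≈0) (≤-respʳ-≈ (sym v≈))
        where
        v≈ : (p + q) + - r ≈ _
        v≈ = +-cong (+-cong p≈ q≈) (-‿cong r≈)

      -- If b i < a j fails, then a i < a j < b i.
      cover₁ : below (0F , i) (0F , j) ≡ true → β i ∨ not (below (0F , j) (1F , i)) ≡ true
      cover₁ ai<aj with below (0F , j) (1F , i) in eq
      ... | true  = ≡.cong (_∨ false) (below-trans (0F , i) (0F , j) (1F , i) ai<aj eq)
      ... | false = ∨-zeroʳ (β i)

      -- If b i < a j fails, then a j < b i < b j.
      cover₂ : below (1F , i) (1F , j) ≡ true → β j ∨ not (below (0F , j) (1F , i)) ≡ true
      cover₂ bi<bj with below (0F , j) (1F , i) in eq
      ... | true  = ≡.cong (_∨ false) (below-trans (0F , j) (1F , i) (1F , j) eq bi<bj)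
      ... | false = ∨-zeroʳ (β j)

      by-cover : ∀ k → (Tight k i j × eval (slack′ k i<j) s ≈ 0#) ⊎ 1# ≤ eval (slack′ k i<j) s
      by-cover 0F = transfer refl (-‿inverseʳ 1#) (s-below (ab i<j)) proj₁
        (cover-slack true false (below (0F , i) (1F , j)) (λ _ → ≡.refl))
      by-cover 1F = transfer (s-below (ii {i})) 1-s-below (s-below (aa i<j)) (λ t → t)
        (cover-slack _ _ _ cover₁)
      by-cover 2F = transfer (s-below (ii {j})) 1-s-below (s-below (bb i<j)) (λ t → t)
        (cover-slack _ _ _ cover₂)

    slack-integral : ∀ d → eval (slack d) s ≈ 0# ⊎ 1# ≤ eval (slack d) s
    slack-integral (k , pair i j i<j) = Sum.map₁ proj₂ (slack-dichotomy k _)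

    module _ (s-tight : ∀ d → eval (slack d) s ≈ 0#) where

      tight : ∀ k {i j : Fin n} → i Fin.< j → Tight k i j
      tight k {i} {j} i<j with slack-dichotomy k (recompute (i Fin.<? j) i<j)
      ... | inj₁ (t , _) = t
      ... | inj₂ 1≤slack = contradiction (≤-respʳ-≈ (s-tight (k , pair i j i<j)) 1≤slack) 1≰0

      -- Read the variables as β i, β j, [a j < b i], [a i < a j] and [b i < b j]. Disjointness
      -- forces `t` once `p` or `q` holds. For `p` and `q` both false the equations still allow `t`
      -- to be true, with `r′` false; the last hypothesis excludes this.
      bits-determine : ∀ p q t r r′ →
        r  ≡ p ∨ not t → p ∧ not t ≡ false →
        r′ ≡ q ∨ not t → q ∧ not t ≡ false →
        (p ≡ false → r′ ≡ true) →
        t ≡ p ∨ q × r ≡ not (q ∧ not p) × r′ ≡ not (p ∧ not q)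
      bits-determine true  true  true  _ _ ≡.refl _ ≡.refl _ _ = ≡.refl , ≡.refl , ≡.refl
      bits-determine true  false true  _ _ ≡.refl _ ≡.refl _ _ = ≡.refl , ≡.refl , ≡.refl
      bits-determine false true  true  _ _ ≡.refl _ ≡.refl _ _ = ≡.refl , ≡.refl , ≡.refl
      bits-determine false false false _ _ ≡.refl _ ≡.refl _ _ = ≡.refl , ≡.refl , ≡.refl
      bits-determine false false true  _ _ ≡.refl _ ≡.refl _ h = case h ≡.refl of λ ()

      below-determined : ∀ {i j : Fin n} → i Fin.< j →
        below (0F , j) (1F , i) ≡ β i ∨ β j ×
        below (0F , i) (0F , j) ≡ not (β j ∧ not (β i)) ×
        below (1F , i) (1F , j) ≡ not (β i ∧ not (β j))
      below-determined {i} {j} i<j = bits-determine _ _ _ _ _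
        (proj₁ (tight 1F i<j)) (proj₂ (tight 1F i<j))
        (proj₁ (tight 2F i<j)) (proj₂ (tight 2F i<j))
        -- Here the inequality [a i < b j] ≤ 1 is used: b i < a i < b j.
        (λ ¬ai<bi → L⇒below (1F , i) (1F , j)
          (L-trans (¬below⇒L (ii {i}) ¬ai<bi) (below⇒L (0F , i) (1F , j) (tight 0F i<j))))

      below-precedes : ∀ {u v} (p : Increasing u v) → below u v ≡ precedes β p
      below-precedes (aa i<j) = proj₁ (proj₂ (below-determined i<j))
      below-precedes (bb i<j) = proj₂ (proj₂ (below-determined i<j))
      below-precedes (ab i<j) = tight 0F i<j
      below-precedes (ba i<j) = proj₁ (below-determined i<j)
      below-precedes ii       = ≡.refl

      to-vertex≋s : evalAll to (vertex β) ≋ s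
      to-vertex≋s p = begin
        eval (to p) (vertex β)             ≈⟨ precedence-vertex β p′ ⟩
        indicator (precedes β p′)          ≡⟨ ≡.cong indicator (below-precedes p′) ⟨
        indicator (below (label (PairsIn.fst p)) (label (PairsIn.snd p))) ≈⟨ s-below p′ ⟨
        s (index p′)                       ≡⟨ ≡.cong s (index-surjective p) ⟩
        s p                                ∎
        where
        open SetoidReasoning setoid
        p′ = labels-increasing p

-- Assembly of the face from the inequalities.

open import Level using (suc)

theorem1 : {c ℓ : Level} (K : OrderedField c ℓ) (n : ℕ) →
    let open Polytopes K in
    Σ[ F ∈ Pred (Point (LOPIndex (2 * n))) (suc 0ℓ ⊔ c ⊔ ℓ) ]
    IsFaceOf F (LOP (2 * n)) × AffinelyEquivalent (BQP n) F
theorem1 K n =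
  -- For n ≤ 1 the list of constraints is empty, and the face is the whole polytope.
  conv≃face to from slack (cartesianProduct (allFin 3) (allPairs n))
    (λ (k , p) → ∈-cartesianProduct⁺ (∈-allFin k) (∈-allPairs p))
    -- The origin is the vertex that shows each hyperplane meets the polytope and that stands in
    -- where a weight vanishes.
    slack-nonconstant (_ , vertex-isVertex (λ _ → false)) to-isVertex from∘to to-tight
    (λ (_ , isSTO , s-char) → LinearOrder.slack-integral isSTO s-char)
    (λ {s} (_ , isSTO , s-char) s-tight →
      _ , vertex-isVertex (LinearOrder.β isSTO {s} s-char) , LinearOrder.to-vertex≋s isSTO s-char s-tight)
  where
  open PolytopeProperties K
  open BooleanQuadricFace K n
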